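{- The $3$-adic generalized exceptional set $\mathcal{E}_\star(\mathbb{Z}_3)$ satisfies $$\dim_H(\mathcal{E}_\star(\mathbb{Z}_3))\ge\tfrac12\log_3 2\approx0.315464.$$ In fact, with $N_m=3^m+1$, $$\dim_H\left(\{\lambda\in\Sigma_{3,\bar2}: N_{2k+1}\lambda\in\Sigma_{3,\bar2}\ \text{for all } k\ge1\}\right)\ge\tfrac12\log_3 2.$$
   Context: $\mathbb{Z}_3$ denotes the $3$-adic integers with the $3$-adic metric ($|3|_3=1/3$), and $\dim_H$ is Hausdorff dimension with respect to it. $\Sigma_{3,\bar2}\subset\mathbb{Z}_3$ is the set of all $\sum_{j\ge0}a_j3^j$ with every $a_j\in\{0,1\}$ (the $3$-adic integers whose expansion omits the digit $2$). The $3$-adic generalized exceptional set $\mathcal{E}_\star(\mathbb{Z}_3)$ is the set of $\lambda\in\mathbb{Z}_3$ such that there are infinitely many integers $M\ge1$ with $M\not\equiv0\pmod3$, including $M=1$, for which $M\lambda\in\Sigma_{3,\bar2}$. -}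

module Defs where

open import Algebra.Definitions.RawSemiring using () renaming (_^_ to pow)
open import Data.Fin using (Fin; toℕ)
open import Data.Fin.Properties using (toℕ-fromℕ<)
open import Data.Integer using (+_)
open import Data.Nat as ℕ using (ℕ; zero; suc; NonZero)
open import Data.Nat.Divisibility using (_∤_; n∣m*n)
import Data.Nat.DivMod as ℕ
import Data.Nat.Properties as ℕ
open import Data.Product using (Σ; ∃; ∃-syntax; _×_; _,_; proj₁; proj₂)
open import Data.Rational as ℚ using (ℚ; 0ℚ; ½; _/_)
import Data.Rational.Properties as ℚ
open import Data.Sum using (_⊎_; inj₁; inj₂)
open import Level using (Level; 0ℓ; _⊔_) renaming (suc to lsuc)
open import Relation.Binary.PropositionalEquality
open import Relation.Unary using (Pred; _∈_; _⊆_; ⋃)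

private variable
  a b c : Level

infixr 8 _^ℚ_
_^ℚ_ : ℚ → ℕ → ℚ
_^ℚ_ = pow ℚ.+-*-rawSemiring

-- An element x of [0,∞] is the Dedekind lower cut { q ∈ ℚ : q < x }.
-- Every negative rational lies in it; 0 is the set of negative rationals
-- and ∞ is all of ℚ.  Classically these cuts are exactly the extended
-- nonnegative reals.  The level is that of the truth values q < x.
record [0,∞] a : Set (lsuc a) where
  field
    below    : ℚ → Set a
    negative : ∀ {q} → q ℚ.< 0ℚ → below q
    lower    : ∀ {p q} → p ℚ.< q → below q → below p
    rounded  : ∀ {q} → below q → ∃[ r ] q ℚ.< r × below r
open [0,∞]

infix 4 _<ᴿ_ _≤ᴿ_

_<ᴿ_ : ℚ → [0,∞] a → Set a
q <ᴿ x = below x q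

_≤ᴿ_ : [0,∞] a → [0,∞] b → Set (a ⊔ b)
x ≤ᴿ y = ∀ {q} → q <ᴿ x → q <ᴿ y

-- For negative r this is 0.
ι : ℚ → [0,∞] 0ℓ
ι r .below q = q ℚ.< 0ℚ ⊎ q ℚ.< r
ι r .negative = inj₁
ι r .lower p<q (inj₁ q<0) = inj₁ (ℚ.<-trans p<q q<0)
ι r .lower p<q (inj₂ q<r) = inj₂ (ℚ.<-trans p<q q<r)
ι r .rounded (inj₁ q<0) = let m , q<m , m<0 = ℚ.<-dense q<0 in m , q<m , inj₁ m<0
ι r .rounded (inj₂ q<r) = let m , q<m , m<r = ℚ.<-dense q<r in m , q<m , inj₂ m<r

-- Supremum in [0,∞]; the empty family has supremum 0.
⨆ : {I : Set a} → (I → [0,∞] b) → [0,∞] (a ⊔ b)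
⨆ {a} {b} {I} x = record
  { below    = λ q → q <ᴿ ι 0ℚ ⊎ ∃[ i ] q <ᴿ x i
  ; negative = λ q<0 → inj₁ (inj₁ q<0)
  ; lower    = λ { p<q (inj₁ q<0) → inj₁ (lower (ι 0ℚ) p<q q<0)
                 ; p<q (inj₂ (i , q<x)) → inj₂ (i , lower (x i) p<q q<x) }
  ; rounded  = λ { (inj₁ q<0) → let r , q<r , r<0 = rounded (ι 0ℚ) q<0 in r , q<r , inj₁ r<0
                 ; (inj₂ (i , q<x)) → let r , q<r , r<x = rounded (x i) q<x
                                      in r , q<r , inj₂ (i , r<x) }
  }

-- Infimum in [0,∞]; the empty family has infimum ∞.  The intermediate r
-- makes the intersection of the cuts rounded again.
⨅ : {I : Set a} → (I → [0,∞] b) → [0,∞] (a ⊔ b)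
⨅ x = record
  { below    = λ q → ∃[ r ] q ℚ.< r × (∀ i → r <ᴿ x i)
  ; negative = λ q<0 → let m , q<m , m<0 = ℚ.<-dense q<0 in m , q<m , λ i → negative (x i) m<0
  ; lower    = λ p<q (r , q<r , r<x) → r , ℚ.<-trans p<q q<r , r<x
  ; rounded  = λ (r , q<r , r<x) → let m , q<m , m<r = ℚ.<-dense q<r in m , q<m , r , m<r , r<x
  }

infixl 6 _+ᴿ_
_+ᴿ_ : [0,∞] a → [0,∞] b → [0,∞] (a ⊔ b)
(x +ᴿ y) .below q = ∃[ r ] ∃[ s ] r <ᴿ x × s <ᴿ y × q ℚ.≤ r ℚ.+ s
(x +ᴿ y) .negative {q} q<0 =
  let m , q<m , m<0 = ℚ.<-dense q<0
      d = q ℚ.- m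
      d<0 = subst (d ℚ.<_) (ℚ.+-inverseʳ m) (ℚ.+-monoˡ-< (ℚ.- m) q<m)
      q≡m+d = trans (sym (ℚ.+-identityʳ q))
              (trans (cong (q ℚ.+_) (sym (ℚ.+-inverseˡ m)))
              (trans (sym (ℚ.+-assoc q (ℚ.- m) m)) (ℚ.+-comm d m)))
  in m , d , negative x m<0 , negative y d<0 , ℚ.≤-reflexive q≡m+d
(x +ᴿ y) .lower p<q (r , s , r<x , s<y , q≤) = r , s , r<x , s<y , ℚ.≤-trans (ℚ.<⇒≤ p<q) q≤
(x +ᴿ y) .rounded (r , s , r<x , s<y , q≤) =
  let r′ , r<r′ , r′<x = rounded x r<x
  in r′ ℚ.+ s , ℚ.≤-<-trans q≤ (ℚ.+-monoˡ-< s r<r′) , r′ , s , r′<x , s<y , ℚ.≤-refl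

partialSum : (ℕ → [0,∞] a) → ℕ → [0,∞] a
partialSum x zero    = x zero
partialSum x (suc n) = partialSum x n +ᴿ x (suc n)

∑ : (ℕ → [0,∞] a) → [0,∞] a
∑ x = ⨆ (partialSum x)

½·_ : [0,∞] a → [0,∞] a
½· x = ⨆ {I = ∃ (_<ᴿ x)} λ (q , _) → ι (½ ℚ.* q)

-- A rational q with q ≤ r^(m/n) for some rational 0 ≤ r < t and m/n ≥ s.
record PowerMinorant (t : [0,∞] a) (s : [0,∞] b) : Set (a ⊔ b) where
  field
    m n      : ℕ
    {{n≢0}}  : NonZero n
    s≤m/n    : s ≤ᴿ ι (+ m / n)
    r        : ℚ
    0≤r      : 0ℚ ℚ.≤ r
    r<t      : r <ᴿ t
    q        : ℚ
    0≤q      : 0ℚ ℚ.≤ q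
    qⁿ≤rᵐ    : q ^ℚ n ℚ.≤ r ^ℚ m

-- The power t^s, for real 0 ≤ t ≤ 1 and real 0 < s < ∞ only: in that range
-- t^p is nonincreasing in p, so t^s is the supremum of t^p over rational
-- p ≥ s.
infixr 8 _^ᴿ_
_^ᴿ_ : [0,∞] a → [0,∞] b → [0,∞] (a ⊔ b)
t ^ᴿ s = ⨆ {I = PowerMinorant t s} λ p → ι (PowerMinorant.q p)

-- m/n ≤ log₃ 2 exactly when 3^m ≤ 2^n.
log₃2 : [0,∞] 0ℓ
log₃2 = ⨆ {I = ∃[ m ] ∃[ n ] 3 ℕ.^ m ℕ.≤ 2 ℕ.^ suc n} λ (m , n , _) → ι (+ m / suc n)

-- x stands for ∑ⱼ x(j)·3ʲ.
ℤ₃ : Set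
ℤ₃ = ℕ → Fin 3

-- The residue of x modulo 3ⁿ in {0, …, 3ⁿ-1}.
_mod3^_ : ℤ₃ → ℕ → ℕ
x mod3^ zero  = 0
x mod3^ suc n = x mod3^ n ℕ.+ toℕ (x n) ℕ.* 3 ℕ.^ n

infixl 7 _/3^_ _%3^_
_/3^_ _%3^_ : ℕ → ℕ → ℕ
m /3^ n = ℕ._/_ m (3 ℕ.^ n) {{ℕ.m^n≢0 3 n}}
m %3^ n = ℕ._%_ m (3 ℕ.^ n) {{ℕ.m^n≢0 3 n}}

-- The product Mx in ℤ₃: its n-th digit is that of the natural number
-- M·(x mod 3ⁿ⁺¹), to which Mx is congruent modulo 3ⁿ⁺¹.
infixr 7 _•_
_•_ : ℕ → ℤ₃ → ℤ₃
(M • x) n = (M ℕ.* (x mod3^ suc n) /3^ n) ℕ.mod 3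

•-mod : ∀ M x n → (M • x) mod3^ n ≡ M ℕ.* (x mod3^ n) %3^ n
•-mod M x zero = sym (ℕ.n%1≡0 (M ℕ.* 0))
•-mod M x (suc n) =
  trans (cong₂ (λ u v → u ℕ.+ v ℕ.* 3 ℕ.^ n) (•-mod M x n)
               (toℕ-fromℕ< (ℕ.m%n<n (M ℕ.* (x mod3^ suc n) /3^ n) 3)))
        (step (3 ℕ.^ n) {{ℕ.m^n≢0 3 n}} {{ℕ.m^n≢0 3 (suc n)}} (x mod3^ n) (toℕ (x n)))
  where
  open ≡-Reasoning
  step : ∀ P .{{_ : NonZero P}} {{_ : NonZero (3 ℕ.* P)}} T d →
         let X = M ℕ.* (T ℕ.+ d ℕ.* P) in
         M ℕ.* T ℕ.% P ℕ.+ (X ℕ./ P ℕ.% 3) ℕ.* P ≡ X ℕ.% (3 ℕ.* P)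
  step P T d = begin
    M ℕ.* T ℕ.% P ℕ.+ (X ℕ./ P ℕ.% 3) ℕ.* P
      ≡⟨ cong₂ (λ u v → u ℕ.+ v ℕ.* P) X%P (ℕ.m%[n*o]/o≡m/o%n X 3 P) ⟨
    X ℕ.% P ℕ.+ (X ℕ.% (3 ℕ.* P) ℕ./ P) ℕ.* P
      ≡⟨ cong (ℕ._+ (X ℕ.% (3 ℕ.* P) ℕ./ P) ℕ.* P)
              (ℕ.m∣n⇒o%n%m≡o%m P (3 ℕ.* P) X (n∣m*n 3)) ⟨
    X ℕ.% (3 ℕ.* P) ℕ.% P ℕ.+ (X ℕ.% (3 ℕ.* P) ℕ./ P) ℕ.* P
      ≡⟨ ℕ.m≡m%n+[m/n]*n (X ℕ.% (3 ℕ.* P)) P ⟨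
    X ℕ.% (3 ℕ.* P) ∎
    where
    X = M ℕ.* (T ℕ.+ d ℕ.* P)
    X%P : X ℕ.% P ≡ M ℕ.* T ℕ.% P
    X%P = trans
      (cong (ℕ._% P) (trans (ℕ.*-distribˡ-+ M T (d ℕ.* P))
                            (cong (M ℕ.* T ℕ.+_) (sym (ℕ.*-assoc M d P)))))
      (ℕ.[m+kn]%n≡m%n (M ℕ.* T) (M ℕ.* d) P)

-- |x - y|₃ is 3⁻ⁿ for the least n with x(n) ≢ y(n), i.e. the largest such
-- 3⁻ⁿ, and 0 if x and y have the same digits.
dist : ℤ₃ → ℤ₃ → [0,∞] 0ℓ
dist x y = ⨆ {I = ∃[ n ] x n ≢ y n} λ (n , _) → ι ((+ 1 / 3) ^ℚ n)

-- These definitions are meant to be read classically: a positive lower bound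
-- on a measure over countable covers rests on compactness of the Cantor
-- space, which is not constructively provable, so such bounds are stated
-- under excluded middle.

diam : Pred ℤ₃ 0ℓ → [0,∞] 0ℓ
diam U = ⨆ {I = ∃[ x ] ∃[ y ] x ∈ U × y ∈ U} λ (x , y , _) → dist x y

-- Finite covers are included: pad with ∅, whose diameter is 0.
record Cover (S : Pred ℤ₃ 0ℓ) (δ : ℚ) : Set₁ where
  field
    U      : ℕ → Pred ℤ₃ 0ℓ
    covers : S ⊆ ⋃ ℕ U
    small  : ∀ i → diam (U i) ≤ᴿ ι δ

ℋ[_,_] : [0,∞] 0ℓ → ℚ → Pred ℤ₃ 0ℓ → [0,∞] (lsuc 0ℓ)
ℋ[ s , δ ] S = ⨅ {I = Cover S δ} λ 𝒰 → ∑ λ i → diam (Cover.U 𝒰 i) ^ᴿ s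

-- The limit as δ → 0 is a supremum, as ℋ[ s , δ ] S grows when δ decreases.
ℋ : [0,∞] 0ℓ → Pred ℤ₃ 0ℓ → [0,∞] (lsuc 0ℓ)
ℋ s S = ⨆ {I = ∃[ δ ] 0ℚ ℚ.< δ} λ (δ , _) → ℋ[ s , δ ] S

Finite : [0,∞] a → Set a
Finite x = ∃[ q ] x ≤ᴿ ι q

-- inf { s real : s > 0, ℋˢ(S) = 0 }.  Leaving out s = 0 does not change the
-- infimum, since ℋ⁰(S) = 0 forces ℋˢ(S) = 0 for all s > 0.
dimH : Pred ℤ₃ 0ℓ → [0,∞] (lsuc 0ℓ)
dimH S = ⨅ {I = ∃[ s ] 0ℚ <ᴿ s × Finite s × ℋ s S ≤ᴿ ι 0ℚ} proj₁

Σ₃,₂̄ : Pred ℤ₃ 0ℓ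
Σ₃,₂̄ x = ∀ j → x j ≡ Fin.zero ⊎ x j ≡ Fin.suc Fin.zero

ℰ⋆ : Pred ℤ₃ 0ℓ
ℰ⋆ x = 1 • x ∈ Σ₃,₂̄ × (∀ B → ∃[ M ] B ℕ.< M × 3 ∤ M × M • x ∈ Σ₃,₂̄)

N : ℕ → ℕ
N m = 3 ℕ.^ m ℕ.+ 1

{-# OPTIONS --safe #-}
module Submission where

-- If x has all its digits in {0,1} and is supported on the even places, then
-- 3²ᵏ⁺¹ x is supported on the odd ones, so adding it to x causes no carries
-- and N₂ₖ₊₁ x has all its digits in {0,1} too.  Such x form a Cantor set, and
-- two of them that first differ in the l-th free digit are 3⁻²ˡ apart.  If
-- s ≤ m/2n with 3ᵐ ≤ 2ⁿ, a set U of such x of diameter 3⁻²ˡ lies in a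
-- cylinder of coin-tossing measure 2⁻ˡ ≤ (diam U)ˢ, and ℋˢ > 0 by the mass
-- distribution principle.

open import Defs
open import Algebra.Bundles using (CommutativeRing)
import Algebra.Properties.CommutativeSemigroup
import Algebra.Properties.Semiring.Exp
import Algebra.Properties.Semiring.Mult
open import Axiom.ExcludedMiddle using (ExcludedMiddle)
open import Data.Bool using (Bool; true; false)
import Data.Bool.Properties as Bool
open import Data.Fin using (Fin; toℕ)
open import Data.Fin.Properties using (toℕ-injective; toℕ<n)
open import Data.Integer as ℤ using (+_)
import Data.Integer.Properties as ℤ
open import Data.List using (List; []; _∷_; length)
open import Data.Maybe using (Maybe; just; nothing)
open import Data.Nat using (_*_; _+_; _≥_)
open import Data.Nat as ℕ using (ℕ; zero; suc; _^_; _<_; s≤s; z≤n; parity)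
open import Data.Nat.Divisibility using (_∤_; ∣m+n∣m⇒∣n; m∣m*n; ∣⇒≤)
open import Data.Nat.DivMod using (_%_; m<n⇒m%n≡m; [m+kn]%n≡m%n)
open import Data.Nat.GeneralisedArithmetic using (fold)
import Data.Nat.Properties as ℕ
open import Data.Nat.Tactic.RingSolver using (solve-∀)
open import Data.Parity.Base using (Parity; 0ℙ; 1ℙ; _⁻¹)
open import Data.Parity.Properties using (⁻¹-selfInverse; suc-homo-⁻¹)
open import Data.Product using (_×_; _,_; ∃-syntax; proj₁; proj₂)
open import Data.Rational as ℚ using (ℚ; 0ℚ; 1ℚ; ½; _/_)
import Data.Rational.Properties as ℚ
open import Data.Rational.Solver using (module +-*-Solver)
import Data.Rational.Unnormalised as ℚᵘ
import Data.Rational.Unnormalised.Properties as ℚᵘ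
open import Data.Sum as Sum using (_⊎_; inj₁; inj₂; swap)
open import Function.Base using (_∘_)
open import Level using (0ℓ)
open import Relation.Binary.PropositionalEquality
open import Relation.Nullary using (yes; no; ¬_; contradiction)
open import Relation.Unary using (_∈_; Pred)

open Algebra.Properties.CommutativeSemigroup
  (CommutativeRing.*-commutativeSemigroup ℚ.+-*-commutativeRing) using (interchange)
open Algebra.Properties.Semiring.Exp
  (CommutativeRing.semiring ℚ.+-*-commutativeRing) using (^-assocʳ)
open Algebra.Properties.Semiring.Mult
  (CommutativeRing.semiring ℚ.+-*-commutativeRing) using (×1-homo-*) renaming (_×_ to _×ℚ_)

-- Natural multiples of 3-adic integers, with carries.

-- z represents M x, with the carries t kept explicit.
Multiple : ℕ → ℤ₃ → ℤ₃ → Set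
Multiple M x z = ∀ n → ∃[ t ] M * (x mod3^ n) ≡ z mod3^ n + t * 3 ^ n

mod3^-< : ∀ x n → x mod3^ n < 3 ^ n
mod3^-< x zero    = s≤s z≤n
mod3^-< x (suc n) = ℕ.+-mono-≤ (mod3^-< x n) (ℕ.*-monoˡ-≤ (3 ^ n) (ℕ.≤-pred (toℕ<n (x n))))

mod3^-injective : ∀ {x y} → (∀ n → x mod3^ n ≡ y mod3^ n) → ∀ n → x n ≡ y n
mod3^-injective {x} {y} eq n = toℕ-injective
  (ℕ.*-cancelʳ-≡ (toℕ (x n)) (toℕ (y n)) (3 ^ n) {{ℕ.m^n≢0 3 n}}
    (ℕ.+-cancelˡ-≡ (y mod3^ n) _ _
      (trans (cong (_+ toℕ (x n) * 3 ^ n) (sym (eq n))) (eq (suc n)))))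

-- Both sides have the same residue modulo every 3ⁿ: reduction kills the carry, and `z mod3^ n` is
-- already below 3ⁿ. All residues together determine the digits.
Multiple⇒•≗ : ∀ {M x z} → Multiple M x z → ∀ n → (M • x) n ≡ z n
Multiple⇒•≗ {M} {x} {z} Mx≈z = mod3^-injective λ n →
  let instance nz = ℕ.m^n≢0 3 n
      t , eq = Mx≈z n
  in begin
    (M • x) mod3^ n                ≡⟨ •-mod M x n ⟩
    M * (x mod3^ n) % 3 ^ n        ≡⟨ cong (_% 3 ^ n) eq ⟩
    (z mod3^ n + t * 3 ^ n) % 3 ^ n ≡⟨ [m+kn]%n≡m%n (z mod3^ n) t (3 ^ n) ⟩
    z mod3^ n % 3 ^ n              ≡⟨ m<n⇒m%n≡m (mod3^-< z n) ⟩
    z mod3^ n                      ∎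
  where open ≡-Reasoning

Multiple-1 : ∀ x → Multiple 1 x x
Multiple-1 x n = 0 , refl

shift : ℤ₃ → ℤ₃
shift x zero    = Fin.zero
shift x (suc n) = x n

shift-mod3^ : ∀ x n → shift x mod3^ suc n ≡ 3 * (x mod3^ n)
shift-mod3^ x zero    = refl
shift-mod3^ x (suc n) = trans (cong (_+ toℕ (x n) * 3 ^ suc n) (shift-mod3^ x n))
                              (lemma (x mod3^ n) (toℕ (x n)) (3 ^ n))
  where
  lemma : ∀ a d p → 3 * a + d * (3 * p) ≡ 3 * (a + d * p)
  lemma = solve-∀

Multiple-shift : ∀ {M x z} → Multiple M x z → Multiple (3 * M) x (shift z)
Multiple-shift {M} {x} {z} Mx≈z zero = 0 , ℕ.*-zeroʳ (3 * M)
Multiple-shift {M} {x} {z} Mx≈z (suc n) with Mx≈z (suc n)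
-- The digit `z n` is pushed past the last place in view and joins the carry, while the old carry is
-- tripled.
... | t , eq = toℕ (z n) + 3 * t , (begin
    3 * M * (x mod3^ suc n)
      ≡⟨ ℕ.*-assoc 3 M (x mod3^ suc n) ⟩
    3 * (M * (x mod3^ suc n))
      ≡⟨ cong (3 *_) eq ⟩
    3 * (z mod3^ n + toℕ (z n) * 3 ^ n + t * 3 ^ suc n)
      ≡⟨ lemma (z mod3^ n) (toℕ (z n)) t (3 ^ n) ⟩
    3 * (z mod3^ n) + (toℕ (z n) + 3 * t) * 3 ^ suc n
      ≡⟨ cong (_+ (toℕ (z n) + 3 * t) * 3 ^ suc n) (shift-mod3^ z n) ⟨
    shift z mod3^ suc n + (toℕ (z n) + 3 * t) * 3 ^ suc n ∎)
  where
  open ≡-Reasoning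
  lemma : ∀ a d t p → 3 * (a + d * p + t * (3 * p)) ≡ 3 * a + (d + 3 * t) * (3 * p)
  lemma = solve-∀

Multiple-3^ : ∀ x k → Multiple (3 ^ k) x (fold x shift k)
Multiple-3^ x zero    = Multiple-1 x
Multiple-3^ x (suc k) = Multiple-shift {3 ^ k} {x} (Multiple-3^ x k)

-- The hypothesis compares digits as natural numbers, so no carry occurs and the residues add in ℕ,
-- not merely modulo 3ⁿ.
mod3^-+ : ∀ {x y w} → (∀ n → toℕ (w n) ≡ toℕ (x n) + toℕ (y n)) →
          ∀ n → w mod3^ n ≡ x mod3^ n + y mod3^ n
mod3^-+ w≡x+y zero = refl
mod3^-+ {x} {y} {w} w≡x+y (suc n) =
  trans (cong₂ (λ a d → a + d * 3 ^ n) (mod3^-+ {x} {y} {w} w≡x+y n) (w≡x+y n))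
        (lemma (x mod3^ n) (y mod3^ n) (toℕ (x n)) (toℕ (y n)) (3 ^ n))
  where
  lemma : ∀ a b c d p → a + b + (c + d) * p ≡ a + c * p + (b + d * p)
  lemma = solve-∀

Multiple-+ : ∀ {M M′ x z z′ w} → Multiple M x z → Multiple M′ x z′ →
             (∀ n → toℕ (w n) ≡ toℕ (z n) + toℕ (z′ n)) → Multiple (M + M′) x w
Multiple-+ {M} {M′} {x} {z} {z′} {w} p p′ w≡z+z′ n with p n | p′ n
... | t , eq | t′ , eq′ = t + t′ , (begin
    (M + M′) * (x mod3^ n)
      ≡⟨ ℕ.*-distribʳ-+ (x mod3^ n) M M′ ⟩
    M * (x mod3^ n) + M′ * (x mod3^ n)
      ≡⟨ cong₂ _+_ eq eq′ ⟩
    z mod3^ n + t * 3 ^ n + (z′ mod3^ n + t′ * 3 ^ n)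
      ≡⟨ lemma (z mod3^ n) t (z′ mod3^ n) t′ (3 ^ n) ⟩
    z mod3^ n + z′ mod3^ n + (t + t′) * 3 ^ n
      ≡⟨ cong (_+ (t + t′) * 3 ^ n) (mod3^-+ {z} {z′} {w} w≡z+z′ n) ⟨
    w mod3^ n + (t + t′) * 3 ^ n ∎)
  where
  open ≡-Reasoning
  lemma : ∀ a t b s p → a + t * p + (b + s * p) ≡ a + b + (t + s) * p
  lemma = solve-∀

-- Supports of one parity and addition without carries.

SupportedOn : Parity → Pred ℤ₃ 0ℓ
SupportedOn p x = ∀ n → parity n ≢ p → x n ≡ Fin.zero

shift-SupportedOn : ∀ {p x} → SupportedOn p x → SupportedOn (p ⁻¹) (shift x)
shift-SupportedOn supp zero    _  = refl
shift-SupportedOn supp (suc n) n≢p⁻¹ = supp n λ n≡p →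
  n≢p⁻¹ (sym (⁻¹-selfInverse (trans (suc-homo-⁻¹ n) n≡p)))

-- Two shifts restore the parity. With the exponent written `k * 2`, a step in `k` unfolds to two
-- shifts by computation.
shift^odd-SupportedOn : ∀ {x} → SupportedOn 0ℙ x → ∀ k → SupportedOn 1ℙ (fold x shift (suc (k * 2)))
shift^odd-SupportedOn supp zero    = shift-SupportedOn supp
shift^odd-SupportedOn supp (suc k) = shift-SupportedOn (shift-SupportedOn (shift^odd-SupportedOn supp k))

shift^-Σ : ∀ {x} → x ∈ Σ₃,₂̄ → ∀ k → fold x shift k ∈ Σ₃,₂̄
shift^-Σ x∈Σ zero    j       = x∈Σ j
shift^-Σ x∈Σ (suc k) zero    = inj₁ refl
shift^-Σ x∈Σ (suc k) (suc j) = shift^-Σ x∈Σ k j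

-- The sum of two digits of which at least one is 0.
overlay : Fin 3 → Fin 3 → Fin 3
overlay Fin.zero    e = e
overlay (Fin.suc d) e = Fin.suc d

toℕ-overlay : ∀ {d e} → d ≡ Fin.zero ⊎ e ≡ Fin.zero → toℕ (overlay d e) ≡ toℕ d + toℕ e
toℕ-overlay                 (inj₁ refl) = refl
toℕ-overlay {Fin.zero}      (inj₂ refl) = refl
toℕ-overlay {Fin.suc d}     (inj₂ refl) = sym (ℕ.+-identityʳ (suc (toℕ d)))

overlay-Σ : ∀ {x y} → x ∈ Σ₃,₂̄ → y ∈ Σ₃,₂̄ → (λ n → overlay (x n) (y n)) ∈ Σ₃,₂̄
overlay-Σ {x} x∈Σ y∈Σ n with x n | x∈Σ n
... | .Fin.zero           | inj₁ refl = y∈Σ n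
... | .(Fin.suc Fin.zero) | inj₂ refl = inj₂ refl

disjoint : ∀ {x y} → SupportedOn 0ℙ x → SupportedOn 1ℙ y → ∀ n → x n ≡ Fin.zero ⊎ y n ≡ Fin.zero
disjoint suppˣ suppʸ n with parity n in eq
... | 0ℙ = inj₂ (suppʸ n λ n≡1 → contradiction (trans (sym eq) n≡1) λ ())
... | 1ℙ = inj₁ (suppˣ n λ n≡0 → contradiction (trans (sym eq) n≡0) λ ())

Multiple-∈Σ : ∀ {M x z} → Multiple M x z → z ∈ Σ₃,₂̄ → M • x ∈ Σ₃,₂̄
Multiple-∈Σ {M} {x} {z} Mx≈z z∈Σ n rewrite Multiple⇒•≗ {M} {x} {z} Mx≈z n = z∈Σ n

-- Adding to x its shift by an odd number of places involves no carries.
N-odd•∈Σ : ∀ {x} → SupportedOn 0ℙ x → x ∈ Σ₃,₂̄ → ∀ k → N (2 * k + 1) • x ∈ Σ₃,₂̄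
N-odd•∈Σ {x} supp x∈Σ k rewrite ℕ.+-comm (2 * k) 1 | ℕ.*-comm 2 k =
  Multiple-∈Σ {N (suc (k * 2))} {x} {λ n → overlay (y n) (x n)}
    (Multiple-+ {3 ^ suc (k * 2)} {1} {x} {y} {x}
      (Multiple-3^ x (suc (k * 2))) (Multiple-1 x)
      λ n → toℕ-overlay {y n} (swap (disjoint {x} {y} supp (shift^odd-SupportedOn supp k) n)))
    (overlay-Σ {y} {x} (shift^-Σ x∈Σ (suc (k * 2))) x∈Σ)
  where
  y = fold x shift (suc (k * 2))

n<3^n : ∀ n → n < 3 ^ n
n<3^n zero    = s≤s z≤n
n<3^n (suc n) = ℕ.≤-trans (ℕ.+-mono-≤ (ℕ.m^n>0 3 n) (n<3^n n)) (ℕ.+-monoʳ-≤ (3 ^ n) (ℕ.m≤m+n (3 ^ n) _))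

3∤N : ∀ m → 3 ∤ N (suc m)
3∤N m 3∣N with ∣⇒≤ (∣m+n∣m⇒∣n 3∣N (m∣m*n (3 ^ m)))
... | s≤s ()

x∈ℰ⋆ : ∀ {x} → SupportedOn 0ℙ x → x ∈ Σ₃,₂̄ → x ∈ ℰ⋆
x∈ℰ⋆ {x} supp x∈Σ = Multiple-∈Σ {1} (Multiple-1 x) x∈Σ , λ B →
  -- This multiplier exceeds `B` because 3ⁿ > n, and it is 1 modulo 3 because its exponent is
  -- positive.
  N (2 * B + 1) ,
  ℕ.≤-trans (s≤s (ℕ.≤-trans (ℕ.m≤m+n B _) (ℕ.m≤m+n (2 * B) 1)))
            (ℕ.≤-trans (n<3^n (2 * B + 1)) (ℕ.m≤m+n _ 1)) ,
  subst (λ m → 3 ∤ N m) (ℕ.+-comm 1 (2 * B)) (3∤N (2 * B)) ,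
  N-odd•∈Σ supp x∈Σ B

-- The Cantor set of free even digits.

bit : Bool → Fin 3
bit false = Fin.zero
bit true  = Fin.suc Fin.zero

spread : (ℕ → Bool) → ℤ₃
spread b zero          = bit (b 0)
spread b (suc zero)    = Fin.zero
spread b (suc (suc n)) = spread (b ∘ suc) n

spread-SupportedOn : ∀ b → SupportedOn 0ℙ (spread b)
spread-SupportedOn b zero          0≢0 = contradiction refl 0≢0
spread-SupportedOn b (suc zero)    _   = refl
spread-SupportedOn b (suc (suc n)) n≢0 = spread-SupportedOn (b ∘ suc) n n≢0

bit-01 : ∀ a → bit a ≡ Fin.zero ⊎ bit a ≡ Fin.suc Fin.zero
bit-01 false = inj₁ refl
bit-01 true  = inj₂ refl

bit-injective : ∀ {a a′} → bit a ≡ bit a′ → a ≡ a′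
bit-injective {false} {false} _ = refl
bit-injective {true}  {true}  _ = refl

spread-Σ : ∀ b → spread b ∈ Σ₃,₂̄
spread-Σ b zero          = bit-01 (b 0)
spread-Σ b (suc zero)    = inj₁ refl
spread-Σ b (suc (suc n)) = spread-Σ (b ∘ suc) n

spread-even : ∀ b l → spread b (l * 2) ≡ bit (b l)
spread-even b zero    = refl
spread-even b (suc l) = spread-even (b ∘ suc) l

-- Powers of rationals, and 1/2 against 1/3.

-- Matches the halving in `½·_` with the single fraction that `PowerMinorant` takes as exponent.
½*m/n : ∀ m n → ½ ℚ.* (+ m / suc n) ≡ + m / (2 ℕ.* suc n)
½*m/n m n = ℚ.toℚᵘ-injective (begin
  ℚ.toℚᵘ (½ ℚ.* (+ m / suc n))          ≈⟨ ℚ.toℚᵘ-homo-* ½ (+ m / suc n) ⟩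
  ℚᵘ.½ ℚᵘ.* ℚ.toℚᵘ (+ m / suc n)        ≈⟨ ℚᵘ.*-congˡ {ℚᵘ.½} (ℚ.toℚᵘ-fromℚᵘ (ℚᵘ.mkℚᵘ (+ m) n)) ⟩
  ℚᵘ.½ ℚᵘ.* ℚᵘ.mkℚᵘ (+ m) n             ≈⟨ ℚᵘ.*≡* (cong (ℤ._* (+ (2 ℕ.* suc n))) (ℤ.*-identityˡ (+ m))) ⟩
  (+ m) ℚᵘ./ (2 ℕ.* suc n)              ≈⟨ ℚ.toℚᵘ-fromℚᵘ ((+ m) ℚᵘ./ (2 ℕ.* suc n)) ⟨
  ℚ.toℚᵘ (+ m / (2 ℕ.* suc n))          ∎)
  where open ℚᵘ.≃-Reasoning

⅓ : ℚ
⅓ = + 1 / 3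

*-mono-≤-nonNeg : ∀ {x y u v} → 0ℚ ℚ.≤ u → 0ℚ ℚ.≤ y → x ℚ.≤ y → u ℚ.≤ v → x ℚ.* u ℚ.≤ y ℚ.* v
*-mono-≤-nonNeg {x} {y} {u} {v} 0≤u 0≤y x≤y u≤v = ℚ.≤-trans
  (ℚ.*-monoʳ-≤-nonNeg u {{ℚ.nonNegative 0≤u}} x≤y)
  (ℚ.*-monoˡ-≤-nonNeg y {{ℚ.nonNegative 0≤y}} u≤v)

^-pos : ∀ {x} → 0ℚ ℚ.< x → ∀ n → 0ℚ ℚ.< x ^ℚ n
^-pos         0<x zero    = ℚ.positive⁻¹ 1ℚ
^-pos {x} 0<x (suc n) =
  ℚ.positive⁻¹ _ {{ℚ.pos*pos⇒pos x {{ℚ.positive 0<x}} (x ^ℚ n) {{ℚ.positive (^-pos 0<x n)}}}}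

^-mono-≤ : ∀ {x y} → 0ℚ ℚ.< x → x ℚ.≤ y → ∀ n → x ^ℚ n ℚ.≤ y ^ℚ n
^-mono-≤ 0<x x≤y zero    = ℚ.≤-refl
^-mono-≤ 0<x x≤y (suc n) =
  *-mono-≤-nonNeg (ℚ.<⇒≤ (^-pos 0<x n)) (ℚ.≤-trans (ℚ.<⇒≤ 0<x) x≤y) x≤y (^-mono-≤ 0<x x≤y n)

^-≤1 : ∀ {x} → 0ℚ ℚ.< x → x ℚ.≤ 1ℚ → ∀ n → x ^ℚ n ℚ.≤ 1ℚ
^-≤1 0<x x≤1 zero    = ℚ.≤-refl
^-≤1 0<x x≤1 (suc n) =
  *-mono-≤-nonNeg {v = 1ℚ} (ℚ.<⇒≤ (^-pos 0<x n)) (ℚ.nonNegative⁻¹ 1ℚ) x≤1 (^-≤1 0<x x≤1 n)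

×1-nonNeg : ∀ n → 0ℚ ℚ.≤ n ×ℚ 1ℚ
×1-nonNeg zero    = ℚ.≤-refl
×1-nonNeg (suc n) = ℚ.+-mono-≤ (ℚ.nonNegative⁻¹ 1ℚ) (×1-nonNeg n)

×1-mono-≤ : ∀ {m n} → m ℕ.≤ n → m ×ℚ 1ℚ ℚ.≤ n ×ℚ 1ℚ
×1-mono-≤ {n = n} ℕ.z≤n = ×1-nonNeg n
×1-mono-≤ (ℕ.s≤s m≤n)   = ℚ.+-monoʳ-≤ 1ℚ (×1-mono-≤ m≤n)

^-inverse : ∀ {x} c → x ℚ.* (c ×ℚ 1ℚ) ≡ 1ℚ → ∀ n → x ^ℚ n ℚ.* ((c ℕ.^ n) ×ℚ 1ℚ) ≡ 1ℚ
^-inverse         c xc≡1 zero    = refl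
^-inverse {x} c xc≡1 (suc n) = begin
  x ℚ.* y ℚ.* ((c ℕ.* c ℕ.^ n) ×ℚ 1ℚ)             ≡⟨ cong (x ℚ.* y ℚ.*_) (×1-homo-* c (c ℕ.^ n)) ⟩
  x ℚ.* y ℚ.* ((c ×ℚ 1ℚ) ℚ.* ((c ℕ.^ n) ×ℚ 1ℚ))   ≡⟨ interchange x y (c ×ℚ 1ℚ) ((c ℕ.^ n) ×ℚ 1ℚ) ⟩
  x ℚ.* (c ×ℚ 1ℚ) ℚ.* (y ℚ.* ((c ℕ.^ n) ×ℚ 1ℚ))   ≡⟨ cong₂ ℚ._*_ xc≡1 (^-inverse c xc≡1 n) ⟩
  1ℚ                                              ∎
  where
  open ≡-Reasoning
  y = x ^ℚ n

-- Multiplied by 2ⁿ, the left side becomes 1 = 3⁻ᵐ · 3ᵐ, which is at most 3⁻ᵐ · 2ⁿ.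
½^≤⅓^ : ∀ m n → 3 ℕ.^ m ℕ.≤ 2 ℕ.^ n → ½ ^ℚ n ℚ.≤ ⅓ ^ℚ m
½^≤⅓^ m n 3^m≤2^n = ℚ.*-cancelʳ-≤-pos ((2 ℕ.^ n) ×ℚ 1ℚ) {{2^n>0}} (begin
  ½ ^ℚ n ℚ.* ((2 ℕ.^ n) ×ℚ 1ℚ)  ≡⟨ ^-inverse 2 refl n ⟩
  1ℚ                            ≡⟨ ^-inverse 3 refl m ⟨
  ⅓ ^ℚ m ℚ.* ((3 ℕ.^ m) ×ℚ 1ℚ)  ≤⟨ ℚ.*-monoˡ-≤-nonNeg (⅓ ^ℚ m) {{⅓^m≥0}} (×1-mono-≤ 3^m≤2^n) ⟩
  ⅓ ^ℚ m ℚ.* ((2 ℕ.^ n) ×ℚ 1ℚ)  ∎)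
  where
  open ℚ.≤-Reasoning
  ⅓^m≥0 = ℚ.nonNegative (ℚ.<⇒≤ (^-pos (ℚ.positive⁻¹ ⅓) m))
  2^n>0 = ℚ.positive (ℚ.<-≤-trans (ℚ.positive⁻¹ 1ℚ) (×1-mono-≤ (ℕ.m^n>0 2 n)))

-- That is, 3⁻⁽²ˡ⁺¹⁾ raised to the power m/2n is at least 2⁻⁽ˡ⁺¹⁾.
½^-≤-⅓^ : ∀ m n → 3 ℕ.^ m ℕ.≤ 2 ℕ.^ n → ∀ l →
          (½ ^ℚ suc l) ^ℚ (2 ℕ.* n) ℚ.≤ (⅓ ^ℚ suc (l ℕ.* 2)) ^ℚ m
½^-≤-⅓^ m n 3^m≤2^n l = begin
  (½ ^ℚ suc l) ^ℚ (2 ℕ.* n)        ≡⟨ ^-assocʳ ½ (suc l) (2 ℕ.* n) ⟩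
  ½ ^ℚ (suc l ℕ.* (2 ℕ.* n))       ≡⟨ cong (½ ^ℚ_) (lemma l n) ⟩
  ½ ^ℚ (n ℕ.* suc (suc (l ℕ.* 2))) ≡⟨ ^-assocʳ ½ n (suc (suc (l ℕ.* 2))) ⟨
  (½ ^ℚ n) ^ℚ suc (suc (l ℕ.* 2))
    ≤⟨ ℚ.*-monoʳ-≤-nonNeg ((½ ^ℚ n) ^ℚ suc (l ℕ.* 2)) {{ℚ.nonNegative (ℚ.<⇒≤ (^-pos 0<a (suc (l ℕ.* 2))))}} (^-≤1 0<½ ½≤1 n) ⟩
  1ℚ ℚ.* (½ ^ℚ n) ^ℚ suc (l ℕ.* 2) ≡⟨ ℚ.*-identityˡ _ ⟩
  (½ ^ℚ n) ^ℚ suc (l ℕ.* 2)        ≤⟨ ^-mono-≤ 0<a (½^≤⅓^ m n 3^m≤2^n) (suc (l ℕ.* 2)) ⟩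
  (⅓ ^ℚ m) ^ℚ suc (l ℕ.* 2)        ≡⟨ ^-assocʳ ⅓ m (suc (l ℕ.* 2)) ⟩
  ⅓ ^ℚ (m ℕ.* suc (l ℕ.* 2))       ≡⟨ cong (⅓ ^ℚ_) (ℕ.*-comm m _) ⟩
  ⅓ ^ℚ (suc (l ℕ.* 2) ℕ.* m)       ≡⟨ ^-assocʳ ⅓ (suc (l ℕ.* 2)) m ⟨
  (⅓ ^ℚ suc (l ℕ.* 2)) ^ℚ m        ∎
  where
  open ℚ.≤-Reasoning
  0<½ = ℚ.positive⁻¹ ½
  0<a = ^-pos 0<½ n
  ½≤1 : ½ ℚ.≤ 1ℚ
  ½≤1 = ℚ.≤ᵇ⇒≤ _
  lemma : ∀ l n → suc l ℕ.* (2 ℕ.* n) ≡ n ℕ.* suc (suc (l ℕ.* 2))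
  lemma = solve-∀

-- Cylinders and the coin-tossing measure.

infix 4 _≼_
infixr 5 _∷_

data _≼_ : List Bool → (ℕ → Bool) → Set where
  []  : ∀ {b} → [] ≼ b
  _∷_ : ∀ {a v b} → b 0 ≡ a → v ≼ b ∘ suc → a ∷ v ≼ b

weight : Maybe (List Bool) → ℚ
weight nothing  = 0ℚ
weight (just v) = ½ ^ℚ length v

weight-nonNeg : ∀ V → 0ℚ ℚ.≤ weight V
weight-nonNeg nothing  = ℚ.≤-refl
weight-nonNeg (just v) = ℚ.<⇒≤ (^-pos (ℚ.positive⁻¹ ½) (length v))

-- just v stands for the cylinder { b : v ≼ b } and nothing for ∅; then ∂ c is
-- the preimage under prepending the bit c.
∂ : Bool → Maybe (List Bool) → Maybe (List Bool)
∂ c     nothing            = nothing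
∂ c     (just [])          = just []
∂ true  (just (true  ∷ v)) = just v
∂ true  (just (false ∷ v)) = nothing
∂ false (just (true  ∷ v)) = nothing
∂ false (just (false ∷ v)) = just v

∂-∷ : ∀ c v → ∂ c (just (c ∷ v)) ≡ just v
∂-∷ true  v = refl
∂-∷ false v = refl

-- Self-similarity of the coin-tossing measure: condition on the first toss.
weight-∂ : ∀ V → weight V ≡ ½ ℚ.* (weight (∂ true V) ℚ.+ weight (∂ false V))
weight-∂ nothing            = refl
weight-∂ (just [])          = refl
weight-∂ (just (true  ∷ v)) = cong (½ ℚ.*_) (sym (ℚ.+-identityʳ (½ ^ℚ length v)))
weight-∂ (just (false ∷ v)) = cong (½ ℚ.*_) (sym (ℚ.+-identityˡ (½ ^ℚ length v)))

total : (ℕ → ℚ) → ℕ → ℚ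
total f zero    = f zero
total f (suc n) = total f n ℚ.+ f (suc n)

module _ {f : ℕ → ℚ} (f≥0 : ∀ i → 0ℚ ℚ.≤ f i) where

  total-nonNeg : ∀ n → 0ℚ ℚ.≤ total f n
  total-nonNeg zero    = f≥0 zero
  total-nonNeg (suc n) = ℚ.+-mono-≤ (total-nonNeg n) (f≥0 (suc n))

  total-grow : ∀ n → total f n ℚ.≤ total f (suc n)
  total-grow n = subst (ℚ._≤ total f (suc n)) (ℚ.+-identityʳ _) (ℚ.+-monoʳ-≤ (total f n) (f≥0 (suc n)))

  total-mono : ∀ {m n} → m ℕ.≤′ n → total f m ℚ.≤ total f n
  total-mono ℕ.≤′-refl       = ℚ.≤-refl
  total-mono {n = suc n} (ℕ.≤′-step m≤n) = ℚ.≤-trans (total-mono m≤n) (total-grow n)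

  term≤total : ∀ n → f n ℚ.≤ total f n
  term≤total zero    = ℚ.≤-refl
  term≤total (suc n) = subst (ℚ._≤ total f (suc n)) (ℚ.+-identityˡ _) (ℚ.+-monoˡ-≤ (f (suc n)) (total-nonNeg n))

total-average : ∀ {f g h} → (∀ i → f i ≡ ½ ℚ.* (g i ℚ.+ h i)) →
                ∀ n → total f n ≡ ½ ℚ.* (total g n ℚ.+ total h n)
total-average eq zero    = eq 0
total-average {f} {g} {h} eq (suc n) =
  trans (cong₂ ℚ._+_ (total-average eq n) (eq (suc n)))
        (solve 4 (λ a b c d → con ½ :* (a :+ b) :+ con ½ :* (c :+ d) := con ½ :* (a :+ c :+ (b :+ d)))
               refl (total g n) (total h n) (g (suc n)) (h (suc n)))
  where open +-*-Solver

-- Total measure at least 1, witnessed by finitely many terms. A cover that is not heavy is one that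
-- compactness must rule out.
Heavy : (ℕ → Maybe (List Bool)) → Set
Heavy W = ∃[ n ] 1ℚ ℚ.≤ total (weight ∘ W) n

-- Partial sums of nonnegative weights grow, so both halves reach 1 by the later of the two indices;
-- then `weight-∂` averages them.
Heavy-average : ∀ {W} → Heavy (∂ true ∘ W) → Heavy (∂ false ∘ W) → Heavy W
Heavy-average {W} (m , 1≤t) (n , 1≤f) = m ℕ.⊔ n , (begin
  1ℚ                   ≤⟨ ℚ.*-monoˡ-≤-nonNeg ½ (ℚ.+-mono-≤ (grow true 1≤t (ℕ.m≤m⊔n m n)) (grow false 1≤f (ℕ.m≤n⊔m m n))) ⟩
  ½ ℚ.* (total (weight ∘ ∂ true ∘ W) (m ℕ.⊔ n) ℚ.+ total (weight ∘ ∂ false ∘ W) (m ℕ.⊔ n))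
                       ≡⟨ total-average (weight-∂ ∘ W) (m ℕ.⊔ n) ⟨
  total (weight ∘ W) (m ℕ.⊔ n) ∎)
  where
  open ℚ.≤-Reasoning
  grow : ∀ c {j k} → 1ℚ ℚ.≤ total (weight ∘ ∂ c ∘ W) j → j ℕ.≤ k → 1ℚ ℚ.≤ total (weight ∘ ∂ c ∘ W) k
  grow c 1≤ j≤k = ℚ.≤-trans 1≤ (total-mono (weight-nonNeg ∘ ∂ c ∘ W) (ℕ.≤⇒≤′ j≤k))

module _ (em : ExcludedMiddle 0ℓ) where

  Light : Set
  Light = ∃[ W ] ¬ Heavy W

  Light-∂ : ((W , _) : Light) → ∃[ c ] ¬ Heavy (∂ c ∘ W)
  Light-∂ (W , ¬h) with em {Heavy (∂ true ∘ W)} | em {Heavy (∂ false ∘ W)}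
  ... | no ¬t | _     = true , ¬t
  ... | yes _ | no ¬f = false , ¬f
  ... | yes t | yes f = contradiction (Heavy-average {W} t f) ¬h

  bit₀ : Light → Bool
  bit₀ = proj₁ ∘ Light-∂

  next : Light → Light
  next (W , ¬h) = let c , ¬hc = Light-∂ (W , ¬h) in ∂ c ∘ W , ¬hc

  branch : Light → ℕ → Bool
  branch s zero    = bit₀ s
  branch s (suc n) = branch (next s) n

  -- Each bit of the branch that agrees with the word shortens it by one letter while the family
  -- stays light. A word wholly consumed would have weight 1 and alone make the family heavy.
  branch-avoids : ∀ s i {v} → proj₁ s i ≡ just v → ¬ v ≼ branch s
  branch-avoids (W , ¬h) i Wi≡v [] =
    ¬h (i , subst (λ V → weight V ℚ.≤ total (weight ∘ W) i) Wi≡v (term≤total (weight-nonNeg ∘ W) i))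
  branch-avoids s i Wi≡v (_∷_ {v = v} refl v≼b) =
    branch-avoids (next s) i (trans (cong (∂ (bit₀ s)) Wi≡v) (∂-∷ (bit₀ s) v)) v≼b

  -- Compactness of Cantor space and the bound on the measure of a finite cover
  -- in one: if the cover is not heavy, neither is its restriction to one of the
  -- two halves, and repeating this gives a branch outside the cover.
  cover⇒Heavy : (v : ℕ → List Bool) → (∀ b → ∃[ i ] v i ≼ b) → Heavy (just ∘ v)
  cover⇒Heavy v covers with em {Heavy (just ∘ v)}
  ... | yes h = h
  ... | no ¬h = let i , vi≼b = covers (branch (just ∘ v , ¬h))
                in contradiction vi≼b (branch-avoids (just ∘ v , ¬h) i refl)

  -- The search for the first disagreement is cut off at `L`, since a family with at most one member
  -- never disagrees.
  common-prefix : {I : Set} (g : I → ℕ → Bool) (L : ℕ) → ∃[ v ]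
    (∀ i → v ≼ g i) × (length v ≡ L ⊎ ∃[ i ] ∃[ j ] g i (length v) ≢ g j (length v))
  common-prefix g zero = [] , (λ _ → []) , inj₁ refl
  common-prefix {I} g (suc L) with em {∃[ i ] g i 0 ≡ true} | em {∃[ i ] g i 0 ≡ false}
  ... | yes (i , t) | yes (j , f) =
    [] , (λ _ → []) , inj₂ (i , j , λ eq → contradiction (trans (sym t) (trans eq f)) λ ())
  -- No member starts with `true`, so all start with `false`; an empty family also ends up here.
  ... | no ¬t | _ = let v , v≼ , len = common-prefix (λ i → g i ∘ suc) L in
    false ∷ v , (λ i → Bool.¬-not (λ t → ¬t (i , t)) ∷ v≼ i) , Sum.map₁ (cong suc) len
  ... | yes _ | no ¬f = let v , v≼ , len = common-prefix (λ i → g i ∘ suc) L in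
    true ∷ v , (λ i → Bool.¬-not (λ f → ¬f (i , f)) ∷ v≼ i) , Sum.map₁ (cong suc) len

-- Lower bounds for sums over a cover, up to summable errors.

total<partialSum : ∀ {x : ℕ → [0,∞] 0ℓ} {q} → (∀ i → q i <ᴿ x i) → ∀ n → total q n <ᴿ partialSum x n
total<partialSum         q<x zero    = q<x zero
total<partialSum {q = q} q<x (suc n) =
  total q n , q (suc n) , total<partialSum q<x n , q<x (suc n) , ℚ.≤-refl

⅛ : ℚ
⅛ = + 1 / 8

module _ {w q : ℕ → ℚ} (w≤q : ∀ i → ½ ℚ.* (½ ℚ.* w i) ℚ.≤ q i ℚ.+ ½ ^ℚ (4 ℕ.+ i)) where

  open ℚ.≤-Reasoning
  open +-*-Solver

  -- The errors 2⁻⁴⁻ⁱ add up to ⅛.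
  total-error : ∀ n → ½ ℚ.* (½ ℚ.* total w n) ℚ.+ ½ ^ℚ (4 ℕ.+ n) ℚ.≤ total q n ℚ.+ ⅛
  total-error zero = subst (½ ℚ.* (½ ℚ.* w 0) ℚ.+ ½ ^ℚ 4 ℚ.≤_) (ℚ.+-assoc (q 0) (½ ^ℚ 4) (½ ^ℚ 4))
    (ℚ.+-monoˡ-≤ (½ ^ℚ 4) (w≤q 0))
  total-error (suc n) = begin
    ½ ℚ.* (½ ℚ.* (T ℚ.+ w (suc n))) ℚ.+ ½ ℚ.* e
      ≡⟨ solve 3 (λ T w e → con ½ :* (con ½ :* (T :+ w)) :+ con ½ :* e
                   := con ½ :* (con ½ :* T) :+ con ½ :* (con ½ :* w) :+ con ½ :* e) refl T (w (suc n)) e ⟩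
    ½ ℚ.* (½ ℚ.* T) ℚ.+ ½ ℚ.* (½ ℚ.* w (suc n)) ℚ.+ ½ ℚ.* e
      ≤⟨ ℚ.+-monoˡ-≤ (½ ℚ.* e) (ℚ.+-monoʳ-≤ (½ ℚ.* (½ ℚ.* T)) (w≤q (suc n))) ⟩
    ½ ℚ.* (½ ℚ.* T) ℚ.+ (q (suc n) ℚ.+ ½ ℚ.* e) ℚ.+ ½ ℚ.* e
      ≡⟨ solve 3 (λ T q e → T :+ (q :+ con ½ :* e) :+ con ½ :* e := T :+ e :+ q)
               refl (½ ℚ.* (½ ℚ.* T)) (q (suc n)) e ⟩
    ½ ℚ.* (½ ℚ.* T) ℚ.+ e ℚ.+ q (suc n)
      ≤⟨ ℚ.+-monoˡ-≤ (q (suc n)) (total-error n) ⟩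
    total q n ℚ.+ ⅛ ℚ.+ q (suc n)
      ≡⟨ solve 3 (λ Q a q → Q :+ a :+ q := Q :+ q :+ a) refl (total q n) ⅛ (q (suc n)) ⟩
    total q n ℚ.+ q (suc n) ℚ.+ ⅛ ∎
    where
    T = total w n
    e = ½ ^ℚ (4 ℕ.+ n)

  -- A quarter of the weight is at least 1/4, and the errors take at most 1/8 of it.
  ⅛≤total : ∀ n → 1ℚ ℚ.≤ total w n → ⅛ ℚ.≤ total q n
  ⅛≤total n 1≤w = begin
    ½ ℚ.* (½ ℚ.* 1ℚ) ℚ.+ 0ℚ ℚ.- ⅛
      ≤⟨ ℚ.+-monoˡ-≤ (ℚ.- ⅛) (ℚ.+-mono-≤
           (ℚ.*-monoˡ-≤-nonNeg ½ (ℚ.*-monoˡ-≤-nonNeg ½ 1≤w))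
           (ℚ.<⇒≤ (^-pos (ℚ.positive⁻¹ ½) (4 ℕ.+ n)))) ⟩
    ½ ℚ.* (½ ℚ.* total w n) ℚ.+ ½ ^ℚ (4 ℕ.+ n) ℚ.- ⅛
      ≤⟨ ℚ.+-monoˡ-≤ (ℚ.- ⅛) (total-error n) ⟩
    total q n ℚ.+ ⅛ ℚ.- ⅛
      ≡⟨ solve 2 (λ Q a → Q :+ a :- a := Q) refl (total q n) ⅛ ⟩
    total q n ∎

cover⇒⅛≤total : ExcludedMiddle 0ℓ → ∀ v q → (∀ b → ∃[ i ] v i ≼ b) →
  (∀ i → ½ ^ℚ (2 ℕ.+ length (v i)) ℚ.≤ q i ℚ.+ ½ ^ℚ (4 ℕ.+ i)) → ∃[ n ] ⅛ ℚ.≤ total q n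
cover⇒⅛≤total em v q covers w≤q = let n , 1≤w = cover⇒Heavy em v covers in
  n , ⅛≤total {weight ∘ just ∘ v} {q} w≤q n 1≤w

-- Mass distribution: positivity of the Hausdorff measure.

½*x<x : ∀ {x} → 0ℚ ℚ.< x → ½ ℚ.* x ℚ.< x
½*x<x {x} 0<x = ℚ.<-respʳ-≡ (ℚ.*-identityˡ x) (ℚ.*-monoˡ-<-pos x {{ℚ.positive 0<x}} {½} {1ℚ} ½<1)
  where
  ½<1 : ½ ℚ.< 1ℚ
  ½<1 = ℚ.*<* (ℤ.+<+ (ℕ.s≤s (ℕ.s≤s ℕ.z≤n)))

module _ (em : ExcludedMiddle 0ℓ) {s : [0,∞] 0ℓ} {m n : ℕ}
         (s≤m/2n : s ≤ᴿ ι (+ m / (2 ℕ.* suc n))) (3^m≤2^n : 3 ℕ.^ m ℕ.≤ 2 ℕ.^ suc n) where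

  -- 2⁻⁽²⁺ˡ⁾ rather than 2⁻ˡ, to stay strictly below each supremum involved.
  ½^<diam^ : ∀ {U b b′} l → spread b ∈ U → spread b′ ∈ U → b l ≢ b′ l →
             ½ ^ℚ (2 ℕ.+ l) <ᴿ diam U ^ᴿ s
  ½^<diam^ {U} {b} {b′} l b∈U b′∈U bl≢b′l = inj₂ (minorant , inj₂ (½*x<x (^-pos (ℚ.positive⁻¹ ½) (suc l))))
    where
    ne : spread b (l ℕ.* 2) ≢ spread b′ (l ℕ.* 2)
    ne eq = bl≢b′l (bit-injective (trans (sym (spread-even b l)) (trans eq (spread-even b′ l))))
    ⅓<1 : ⅓ ℚ.< 1ℚ
    ⅓<1 = ℚ.*<* (ℤ.+<+ (ℕ.s≤s (ℕ.s≤s ℕ.z≤n)))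
    ⅓^>0 = ^-pos (ℚ.positive⁻¹ ⅓)
    ⅓^-drop : ⅓ ^ℚ suc (l ℕ.* 2) ℚ.< ⅓ ^ℚ (l ℕ.* 2)
    ⅓^-drop = ℚ.<-respʳ-≡ (ℚ.*-identityˡ _)
      (ℚ.*-monoˡ-<-pos (⅓ ^ℚ (l ℕ.* 2)) {{ℚ.positive (⅓^>0 (l ℕ.* 2))}} {⅓} {1ℚ} ⅓<1)
    minorant : PowerMinorant (diam U) s
    minorant = record
      { m = m ; n = 2 ℕ.* suc n ; s≤m/n = s≤m/2n
      ; r = ⅓ ^ℚ suc (l ℕ.* 2) ; 0≤r = ℚ.<⇒≤ (⅓^>0 (suc (l ℕ.* 2)))
      ; r<t = inj₂ ((spread b , spread b′ , b∈U , b′∈U) , inj₂ ((l ℕ.* 2 , ne) , inj₂ ⅓^-drop))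
      ; q = ½ ^ℚ suc l ; 0≤q = ℚ.<⇒≤ (^-pos (ℚ.positive⁻¹ ½) (suc l))
      ; qⁿ≤rᵐ = ½^-≤-⅓^ m (suc n) 3^m≤2^n l
      }

  -- The last term pays for sets of diameter below 3⁻²ᴸ, such as points.
  enclosing-word : ∀ U L → ∃[ v ] (∀ b → spread b ∈ U → v ≼ b) ×
    ∃[ q ] q <ᴿ diam U ^ᴿ s × ½ ^ℚ (2 ℕ.+ length v) ℚ.≤ q ℚ.+ ½ ^ℚ (1 ℕ.+ L)
  enclosing-word U L with common-prefix em {∃[ b ] spread b ∈ U} proj₁ L
  ... | v , v≼ , inj₁ refl = v , (λ b b∈U → v≼ (b , b∈U)) ,
    -- `U` may be empty or a point, so only a negative rational is sure to lie below the power of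
    -- its diameter. With `length v` equal to `L`, the error `x` turns -x/2 into exactly the
    -- required x/2.
    ℚ.- (½ ℚ.* x) ,
    negative (diam U ^ᴿ s) (ℚ.neg-antimono-< (^-pos (ℚ.positive⁻¹ ½) (2 ℕ.+ length v))) ,
    ℚ.≤-reflexive (solve 1 (λ x → con ½ :* x := :- (con ½ :* x) :+ x) refl x)
    where
    open +-*-Solver
    open [0,∞]
    x = ½ ^ℚ (1 ℕ.+ length v)
  ... | v , v≼ , inj₂ ((b , b∈U) , (b′ , b′∈U) , ne) = v , (λ b b∈U → v≼ (b , b∈U)) ,
    ½ ^ℚ (2 ℕ.+ length v) , ½^<diam^ (length v) b∈U b′∈U ne ,
    subst (ℚ._≤ ½ ^ℚ (2 ℕ.+ length v) ℚ.+ ½ ^ℚ (1 ℕ.+ L)) (ℚ.+-identityʳ _)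
      (ℚ.+-monoʳ-≤ (½ ^ℚ (2 ℕ.+ length v)) (ℚ.<⇒≤ (^-pos (ℚ.positive⁻¹ ½) (1 ℕ.+ L))))

  module _ {S : Pred ℤ₃ 0ℓ} (spread∈S : ∀ b → spread b ∈ S) where

    cover-sum : ∀ {δ} (𝒰 : Cover S δ) → ∃[ n ] ∃[ t ] ⅛ ℚ.≤ t × t <ᴿ partialSum (λ i → diam (Cover.U 𝒰 i) ^ᴿ s) n
    cover-sum 𝒰 =
      let k , ⅛≤t = cover⇒⅛≤total em v q
            (λ b → let i , b∈U = covers (spread∈S b) in i , proj₁ (proj₂ (enclosed i)) b b∈U)
            (λ i → proj₂ (proj₂ (proj₂ (proj₂ (enclosed i)))))
      in k , total q k , ⅛≤t , total<partialSum {q = q} (λ i → proj₁ (proj₂ (proj₂ (proj₂ (enclosed i))))) k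
      where
      open Cover 𝒰
      -- Cutting off at `3 + i` makes the error term 2⁻⁴⁻ⁱ, as the summation of errors requires.
      enclosed = λ i → enclosing-word (U i) (3 ℕ.+ i)
      v = λ i → proj₁ (enclosed i)
      q = λ i → proj₁ (proj₂ (proj₂ (enclosed i)))

    ℋ-positive : 0ℚ <ᴿ ℋ s S
    -- A single δ suffices because `ℋ` is a supremum over δ; here δ = 1. The infimum over covers
    -- needs one positive rational below all sums, and 1/16 lies strictly under the uniform bound
    -- 1/8.
    ℋ-positive = inj₂ ((1ℚ , ℚ.positive⁻¹ 1ℚ) , + 1 / 16 , ℚ.positive⁻¹ (+ 1 / 16) , λ 𝒰 →
      let n , t , ⅛≤t , t<Σ = cover-sum 𝒰
      in inj₂ (n , [0,∞].lower (partialSum (λ i → diam (Cover.U 𝒰 i) ^ᴿ s) n) (ℚ.<-≤-trans ¹⁄₁₆<⅛ ⅛≤t) t<Σ))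
      where
      ¹⁄₁₆<⅛ : + 1 / 16 ℚ.< ⅛
      ¹⁄₁₆<⅛ = ℚ.*<* (ℤ.+<+ (ℕ.m<m+n 8 {8} (ℕ.s≤s ℕ.z≤n)))

-- From positive measure to dimension.

-- Every layer of `½·_`, `⨆` and `ι` has its own branch for negative rationals. These all collapse
-- into the first alternative; the one remaining branch carries a genuine fraction below log₃ 2.
½·log₃2-cut : ∀ {q} → q <ᴿ ½· log₃2 →
  q ℚ.< 0ℚ ⊎ ∃[ m ] ∃[ n ] 3 ℕ.^ m ℕ.≤ 2 ℕ.^ suc n × q ℚ.< + m / (2 ℕ.* suc n)
½·log₃2-cut (inj₁ (inj₁ q<0)) = inj₁ q<0
½·log₃2-cut (inj₁ (inj₂ q<0)) = inj₁ q<0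
½·log₃2-cut (inj₂ (_ , inj₁ q<0)) = inj₁ q<0
½·log₃2-cut (inj₂ ((p , inj₁ (inj₁ p<0)) , inj₂ q<½p)) = inj₁ (ℚ.<-trans q<½p (ℚ.*-monoʳ-<-pos ½ p<0))
½·log₃2-cut (inj₂ ((p , inj₁ (inj₂ p<0)) , inj₂ q<½p)) = inj₁ (ℚ.<-trans q<½p (ℚ.*-monoʳ-<-pos ½ p<0))
½·log₃2-cut (inj₂ ((p , inj₂ (_ , inj₁ p<0)) , inj₂ q<½p)) = inj₁ (ℚ.<-trans q<½p (ℚ.*-monoʳ-<-pos ½ p<0))
½·log₃2-cut (inj₂ ((p , inj₂ ((m , n , 3^m≤2^n) , inj₂ p<m/n)) , inj₂ q<½p)) =
  inj₂ (m , n , 3^m≤2^n , subst (_ ℚ.<_) (½*m/n m n) (ℚ.<-trans q<½p (ℚ.*-monoʳ-<-pos ½ p<m/n)))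

≮⇒≤ι : ∀ {s : [0,∞] 0ℓ} {r r′} → r ℚ.< r′ → ¬ r <ᴿ s → s ≤ᴿ ι r′
≮⇒≤ι {s} {r} r<r′ r≮s {p} p<s with p ℚ.≤? r
... | yes p≤r = inj₂ (ℚ.≤-<-trans p≤r r<r′)
... | no p≰r  = contradiction ([0,∞].lower s (ℚ.≰⇒> p≰r) p<s) r≮s

0≮0 : ¬ 0ℚ <ᴿ ι 0ℚ
0≮0 = Sum.[ ℚ.<-irrefl refl , ℚ.<-irrefl refl ]

-- An admissible exponent `s` not above `r` would be at most m/2(n+1), where `ℋ-positive`
-- contradicts vanishing measure. Stating it for any set containing the Cantor set serves both
-- claims of the theorem.
½·log₃2≤dimH : ExcludedMiddle 0ℓ → ∀ {S : Pred ℤ₃ 0ℓ} → (∀ b → spread b ∈ S) → ½· log₃2 ≤ᴿ dimH S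
½·log₃2≤dimH em {S} spread∈S q<½log with ½·log₃2-cut q<½log
... | inj₁ q<0 = [0,∞].negative (dimH S) q<0
... | inj₂ (m , n , 3^m≤2^n , q<m/2n) with ℚ.<-dense q<m/2n
-- The cut of an infimum asks for one rational above `q` that is below every admissible `s`; this is
-- `r`.
...   | r , q<r , r<m/2n = r , q<r , r<s
  where
  r<s : ((s , _) : ∃[ s ] 0ℚ <ᴿ s × Finite s × ℋ s S ≤ᴿ ι 0ℚ) → r <ᴿ s
  r<s (s , _ , _ , ℋ≤0) with em {r <ᴿ s}
  ... | yes r<s = r<s
  ... | no r≮s = contradiction
    (ℋ≤0 (ℋ-positive em {s} {m} {n} (≮⇒≤ι {s} r<m/2n r≮s) 3^m≤2^n spread∈S)) 0≮0

theorem1p9 : ExcludedMiddle 0ℓ →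
    (½· log₃2 ≤ᴿ dimH ℰ⋆) ×
    (½· log₃2 ≤ᴿ dimH (λ x → x ∈ Σ₃,₂̄ × (∀ k → k ≥ 1 → N (2 * k + 1) • x ∈ Σ₃,₂̄)))
theorem1p9 em =
  ½·log₃2≤dimH em (λ b → x∈ℰ⋆ {spread b} (spread-SupportedOn b) (spread-Σ b)) ,
  ½·log₃2≤dimH em (λ b → spread-Σ b , λ k _ → N-odd•∈Σ {spread b} (spread-SupportedOn b) (spread-Σ b) k)
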